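{- Let $f(x)=c_0+c_1x+c_2x^2+\cdots$ be a formal power series with complex coefficients and $c_0\neq 0$. Then for any two sequences of complex numbers $\{a_n\}_{n\ge1}$ and $\{b_n\}_{n\ge 1}$ the following two conditions are equivalent: $$a_n=n\sum_{m=1}^n[x^{n-m}]f(x)^m\cdot b_m\quad\text{for all } n=1,2,3,\ldots$$ and $$b_n=\frac 1n\sum_{m=1}^n[x^{n-m}]f(x)^{ -n}\cdot a_m\quad\text{for all } n=1,2,3,\ldots.$$
   Context: $[x^k]g(x)$ denotes the coefficient of $x^k$ in the power series expansion of $g(x)$. For $c_0\ne 0$ and $n\ge 1$, $f(x)^{ -n}$ is the $n$-th power of the multiplicative inverse of $f(x)$ as a power series. -}

module Defs where

open import Algebra.Bundles using (CommutativeRing; RawSemiring)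
open import Algebra.Structures using (IsCommutativeRing)
open import Data.Fin.Base as Fin using (Fin; toℕ)
open import Data.Nat.Base as ℕ using (ℕ; zero; suc; _∸_)
import Data.Nat.Properties as ℕ
open import Data.Product.Base using (∃-syntax; _×_; _,_)
open import Data.Rational.Base as ℚ using (ℚ; 0ℚ; 1ℚ; ½; Positive; ∣_∣)
import Data.Rational.Properties as ℚ
open import Data.Rational.Solver using (module +-*-Solver)
open import Data.Sum.Base using (_⊎_; inj₁; inj₂)
open import Data.Vec.Functional using (Vector; head; []; _∷_)
open import Level using (0ℓ)
open import Relation.Binary.PropositionalEquality
  using (_≡_; _≢_; refl; sym; trans; cong; cong₂; subst)
import Relation.Binary.Reasoning.Setoid as ≈-Reasoning
open import Relation.Nullary using (yes; no; contradiction)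

private
  module Estimates where
    open import Data.Rational.Base using (_+_; _*_; _-_; -_; _<_; _≤_)
    open ℚ.≤-Reasoning
    open +-*-Solver

    halves : ∀ ε → ½ * ε + ½ * ε ≡ ε
    halves = solve 1 (λ ε → con ½ :* ε :+ con ½ :* ε := ε) refl

    0≤pos : ∀ p → .{{Positive p}} → 0ℚ ≤ p
    0≤pos p = ℚ.<⇒≤ (ℚ.positive⁻¹ p)

    ∣p-p∣<ε : ∀ p ε → .{{Positive ε}} → ∣ p - p ∣ < ε
    ∣p-p∣<ε p ε = subst (λ d → ∣ d ∣ < ε) (sym (ℚ.+-inverseʳ p)) (ℚ.positive⁻¹ ε)

    ∣-∣-sym : ∀ p q → ∣ p - q ∣ ≡ ∣ q - p ∣
    ∣-∣-sym p q = trans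
      (cong ∣_∣ (solve 2 (λ p q → p :- q := :- (q :- p)) refl p q))
      (ℚ.∣-p∣≡∣p∣ (q - p))

    +-close : ∀ {p p′ q q′ δ ε} → ∣ p - p′ ∣ < δ → ∣ q - q′ ∣ < ε →
              ∣ (p + q) - (p′ + q′) ∣ < δ + ε
    +-close {p} {p′} {q} {q′} {δ} {ε} p~p′ q~q′ = begin-strict
      ∣ (p + q) - (p′ + q′) ∣  ≡⟨ cong ∣_∣ (solve 4 (λ p p′ q q′ →
                                    (p :+ q) :- (p′ :+ q′) := (p :- p′) :+ (q :- q′))
                                    refl p p′ q q′) ⟩
      ∣ (p - p′) + (q - q′) ∣  ≤⟨ ℚ.∣p+q∣≤∣p∣+∣q∣ (p - p′) (q - q′) ⟩
      ∣ p - p′ ∣ + ∣ q - q′ ∣  <⟨ ℚ.+-mono-< p~p′ q~q′ ⟩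
      δ + ε                    ∎

    trans-close : ∀ {p q r δ ε} → ∣ p - q ∣ < δ → ∣ q - r ∣ < ε →
                  ∣ p - r ∣ < δ + ε
    trans-close {p} {q} {r} {δ} {ε} p~q q~r = begin-strict
      ∣ p - r ∣              ≡⟨ cong ∣_∣ (solve 3 (λ p q r →
                                  p :- r := (p :- q) :+ (q :- r)) refl p q r) ⟩
      ∣ (p - q) + (q - r) ∣  ≤⟨ ℚ.∣p+q∣≤∣p∣+∣q∣ (p - q) (q - r) ⟩
      ∣ p - q ∣ + ∣ q - r ∣  <⟨ ℚ.+-mono-< p~q q~r ⟩
      δ + ε                  ∎

    neg-close : ∀ {p q ε} → ∣ p - q ∣ < ε → ∣ - p - - q ∣ < ε
    neg-close {p} {q} {ε} = subst (_< ε) (sym (trans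
      (cong ∣_∣ (solve 2 (λ p q → :- p :- :- q := :- (p :- q)) refl p q))
      (ℚ.∣-p∣≡∣p∣ (p - q))))

    bound : ∀ {p q} → ∣ p - q ∣ < 1ℚ → ∣ p ∣ < 1ℚ + ∣ q ∣
    bound {p} {q} p~q = begin-strict
      ∣ p ∣              ≡⟨ cong ∣_∣ (solve 2 (λ p q → p := (p :- q) :+ q) refl p q) ⟩
      ∣ (p - q) + q ∣    ≤⟨ ℚ.∣p+q∣≤∣p∣+∣q∣ (p - q) q ⟩
      ∣ p - q ∣ + ∣ q ∣  <⟨ ℚ.+-monoˡ-< ∣ q ∣ p~q ⟩
      1ℚ + ∣ q ∣         ∎

    <-+ʳ : ∀ {p} B C → .{{Positive C}} → p < B → p < B + C
    <-+ʳ {p} B C p<B = begin-strict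
      p       <⟨ p<B ⟩
      B       ≡⟨ ℚ.+-identityʳ B ⟨
      B + 0ℚ  ≤⟨ ℚ.+-monoʳ-≤ B (0≤pos C) ⟩
      B + C   ∎

    <-+ˡ : ∀ {p} B C → .{{Positive B}} → p < C → p < B + C
    <-+ˡ {p} B C p<C = subst (p <_) (ℚ.+-comm C B) (<-+ʳ {p} C B p<C)

    shrink : (B ε : ℚ) → .{{Positive B}} → ℚ
    shrink B ε = (½ * ε) * (ℚ.1/ B) {{ℚ.pos⇒nonZero B}}

    shrink-pos : ∀ B ε → .{{_ : Positive B}} → .{{Positive ε}} → Positive (shrink B ε)
    shrink-pos B ε = ℚ.pos*pos⇒pos (½ * ε) {{ℚ.pos*pos⇒pos ½ ε}}
                                   (ℚ.1/ B) {{ℚ.1/pos⇒pos B}}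
      where instance _ = ℚ.pos⇒nonZero B

    *-shrink : ∀ B ε → .{{_ : Positive B}} → B * shrink B ε ≡ ½ * ε
    *-shrink B ε = begin-equality
      B * ((½ * ε) * ℚ.1/ B)  ≡⟨ solve 3 (λ B h i → B :* (h :* i) := h :* (B :* i))
                                   refl B (½ * ε) (ℚ.1/ B) ⟩
      (½ * ε) * (B * ℚ.1/ B)  ≡⟨ cong ((½ * ε) *_) (ℚ.*-inverseʳ B) ⟩
      (½ * ε) * 1ℚ            ≡⟨ ℚ.*-identityʳ (½ * ε) ⟩
      ½ * ε                   ∎
      where instance _ = ℚ.pos⇒nonZero B

    ∣*∣<half : ∀ {p d} B ε → .{{_ : Positive B}} →
               ∣ p ∣ < B → ∣ d ∣ < shrink B ε → ∣ p * d ∣ < ½ * ε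
    ∣*∣<half {p} {d} B ε p<B d<δ = begin-strict
      ∣ p * d ∣       ≡⟨ ℚ.∣p*q∣≡∣p∣*∣q∣ p d ⟩
      ∣ p ∣ * ∣ d ∣   ≤⟨ ℚ.*-monoʳ-≤-nonNeg ∣ d ∣ {{ℚ.∣-∣-nonNeg d}} (ℚ.<⇒≤ p<B) ⟩
      B * ∣ d ∣       <⟨ ℚ.*-monoʳ-<-pos B d<δ ⟩
      B * shrink B ε  ≡⟨ *-shrink B ε ⟩
      ½ * ε           ∎

    *-close : ∀ {p p′ q q′} B ε → .{{_ : Positive B}} → ∣ p ∣ < B → ∣ q′ ∣ < B →
              ∣ p - p′ ∣ < shrink B ε → ∣ q - q′ ∣ < shrink B ε →
              ∣ p * q - p′ * q′ ∣ < ε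
    *-close {p} {p′} {q} {q′} B ε p<B q′<B p~p′ q~q′ = begin-strict
      ∣ p * q - p′ * q′ ∣                    ≡⟨ cong ∣_∣ (solve 4 (λ p p′ q q′ →
        p :* q :- p′ :* q′ := p :* (q :- q′) :+ q′ :* (p :- p′)) refl p p′ q q′) ⟩
      ∣ p * (q - q′) + q′ * (p - p′) ∣       ≤⟨ ℚ.∣p+q∣≤∣p∣+∣q∣ (p * (q - q′)) (q′ * (p - p′)) ⟩
      ∣ p * (q - q′) ∣ + ∣ q′ * (p - p′) ∣   <⟨ ℚ.+-mono-< (∣*∣<half B ε p<B q~q′)
                                                           (∣*∣<half B ε q′<B p~p′) ⟩
      ½ * ε + ½ * ε                          ≡⟨ halves ε ⟩
      ε                                      ∎

    p-0≡p : ∀ p → p - 0ℚ ≡ p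
    p-0≡p = solve 1 (λ p → p :- con 0ℚ := p) refl

    δ²<∣p*p∣ : ∀ {p δ} → .{{Positive δ}} → δ < ∣ p ∣ → δ * δ < p * p
    δ²<∣p*p∣ {p} {δ} δ<p = begin-strict
      δ * δ          <⟨ ℚ.*-monoʳ-<-pos δ δ<p ⟩
      δ * ∣ p ∣      ≤⟨ ℚ.*-monoʳ-≤-nonNeg ∣ p ∣ {{ℚ.∣-∣-nonNeg p}} (ℚ.<⇒≤ δ<p) ⟩
      ∣ p ∣ * ∣ p ∣  ≡⟨ sq p ⟩
      p * p          ∎
      where
      sq : ∀ p → ∣ p ∣ * ∣ p ∣ ≡ p * p
      sq p with ℚ.∣p∣≡p∨∣p∣≡-p p
      ... | inj₁ eq = cong₂ _*_ eq eq
      ... | inj₂ eq = trans (cong₂ _*_ eq eq)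
                            (solve 1 (λ p → :- p :* :- p := p :* p) refl p)

    0≤p*p : ∀ p → 0ℚ ≤ p * p
    0≤p*p p with ℚ.≤-total 0ℚ p
    ... | inj₁ 0≤p = ℚ.nonNegative⁻¹ (p * p)
                       {{ℚ.nonNeg*nonNeg⇒nonNeg p {{ℚ.nonNegative 0≤p}} p {{ℚ.nonNegative 0≤p}} }}
    ... | inj₂ p≤0 = ℚ.nonNegative⁻¹ (p * p)
                       {{ℚ.nonPos*nonPos⇒nonPos p {{ℚ.nonPositive p≤0}} p {{ℚ.nonPositive p≤0}} }}

    δ²<∣p*p+q*q∣ : ∀ {p q δ} → .{{Positive δ}} → δ < ∣ p ∣ → δ * δ < ∣ p * p + q * q ∣
    δ²<∣p*p+q*q∣ {p} {q} {δ} δ<p = begin-strict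
      δ * δ              <⟨ δ²<∣p*p∣ {p} δ<p ⟩
      p * p              ≡⟨ ℚ.+-identityʳ (p * p) ⟨
      p * p + 0ℚ         ≤⟨ ℚ.+-monoʳ-≤ (p * p) (0≤p*p q) ⟩
      p * p + q * q      ≡⟨ ℚ.0≤p⇒∣p∣≡p (ℚ.+-mono-≤ (0≤p*p p) (0≤p*p q)) ⟨
      ∣ p * p + q * q ∣  ∎

    -- 1/p, with the junk value 0 at p = 0.
    recip : ℚ → ℚ
    recip p with p ℚ.≟ 0ℚ
    ... | yes _  = 0ℚ
    ... | no p≢0 = (ℚ.1/ p) {{ℚ.≢-nonZero p≢0}}

    *-recip : ∀ {p} → p ≢ 0ℚ → p * recip p ≡ 1ℚ
    *-recip {p} p≢0 with p ℚ.≟ 0ℚ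
    ... | yes p≡0  = contradiction p≡0 p≢0
    ... | no  p≢0′ = ℚ.*-inverseʳ p {{ℚ.≢-nonZero p≢0′}}

    apart⇒≢0 : ∀ {p δ} → .{{Positive δ}} → δ < ∣ p ∣ → p ≢ 0ℚ
    apart⇒≢0 {δ = δ} δ<0 refl = ℚ.<-asym δ<0 (ℚ.positive⁻¹ δ)

    recip-close : ∀ {p q} δ ε → .{{_ : Positive δ}} → .{{_ : Positive ε}} →
                  δ < ∣ p ∣ → δ < ∣ q ∣ → ∣ p - q ∣ < ε * (δ * δ) →
                  ∣ recip p - recip q ∣ < ε
    recip-close {p} {q} δ ε δ<p δ<q p~q =
      ℚ.*-cancelʳ-<-nonNeg (∣ p ∣ * ∣ q ∣) {{pq≥0}} (begin-strict
        ∣ recip p - recip q ∣ * (∣ p ∣ * ∣ q ∣)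
          ≡⟨ cong (∣ recip p - recip q ∣ *_) (ℚ.∣p*q∣≡∣p∣*∣q∣ p q) ⟨
        ∣ recip p - recip q ∣ * ∣ p * q ∣
          ≡⟨ ℚ.∣p*q∣≡∣p∣*∣q∣ (recip p - recip q) (p * q) ⟨
        ∣ (recip p - recip q) * (p * q) ∣
          ≡⟨ cong ∣_∣ (solve 4 (λ p q i j →
               (i :- j) :* (p :* q) := (p :* i) :* q :- (q :* j) :* p)
               refl p q (recip p) (recip q)) ⟩
        ∣ (p * recip p) * q - (q * recip q) * p ∣
          ≡⟨ cong ∣_∣ (cong₂ (λ u v → u * q - v * p)
               (*-recip (apart⇒≢0 δ<p)) (*-recip (apart⇒≢0 δ<q))) ⟩
        ∣ 1ℚ * q - 1ℚ * p ∣
          ≡⟨ cong₂ (λ u v → ∣ u - v ∣) (ℚ.*-identityˡ q) (ℚ.*-identityˡ p) ⟩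
        ∣ q - p ∣
          ≡⟨ ∣-∣-sym q p ⟩
        ∣ p - q ∣
          <⟨ p~q ⟩
        ε * (δ * δ)
          ≤⟨ ℚ.*-monoˡ-≤-nonNeg ε {{ℚ.pos⇒nonNeg ε}} (begin
               δ * δ          ≤⟨ ℚ.*-monoˡ-≤-nonNeg δ {{ℚ.pos⇒nonNeg δ}} (ℚ.<⇒≤ δ<q) ⟩
               δ * ∣ q ∣      ≤⟨ ℚ.*-monoʳ-≤-nonNeg ∣ q ∣ {{ℚ.∣-∣-nonNeg q}} (ℚ.<⇒≤ δ<p) ⟩
               ∣ p ∣ * ∣ q ∣  ∎) ⟩
        ε * (∣ p ∣ * ∣ q ∣)
          ∎)
      where
      pq≥0 = subst ℚ.NonNegative (ℚ.∣p*q∣≡∣p∣*∣q∣ p q) (ℚ.∣-∣-nonNeg (p * q))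

  open Estimates

Eventually : (ℕ → Set) → Set
Eventually P = ∃[ N ] (∀ n → N ℕ.≤ n → P n)

Eventually₂ : (ℕ → ℕ → Set) → Set
Eventually₂ P = ∃[ N ] (∀ m n → N ℕ.≤ m → N ℕ.≤ n → P m n)

private
  map : ∀ {P Q} → (∀ n → P n → Q n) → Eventually P → Eventually Q
  map f (N , p) = N , λ n N≤n → f n (p n N≤n)

  zipWith : ∀ {P Q R} → (∀ n → P n → Q n → R n) →
            Eventually P → Eventually Q → Eventually R
  zipWith f (M , p) (N , q) = M ℕ.⊔ N , λ n M⊔N≤n →
    f n (p n (ℕ.m⊔n≤o⇒m≤o M N M⊔N≤n)) (q n (ℕ.m⊔n≤o⇒n≤o M N M⊔N≤n))

  map₂ : ∀ {P Q} → (∀ m n → P m n → Q m n) → Eventually₂ P → Eventually₂ Q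
  map₂ f (N , p) = N , λ m n N≤m N≤n → f m n (p m n N≤m N≤n)

  zipWith₂ : ∀ {P Q R} → (∀ m n → P m n → Q m n → R m n) →
             Eventually₂ P → Eventually₂ Q → Eventually₂ R
  zipWith₂ f (M , p) (N , q) = M ℕ.⊔ N , λ m n M⊔N≤m M⊔N≤n → f m n
    (p m n (ℕ.m⊔n≤o⇒m≤o M N M⊔N≤m) (ℕ.m⊔n≤o⇒m≤o M N M⊔N≤n))
    (q m n (ℕ.m⊔n≤o⇒n≤o M N M⊔N≤m) (ℕ.m⊔n≤o⇒n≤o M N M⊔N≤n))

  both : ∀ {P Q} → Eventually P → Eventually Q → Eventually₂ (λ m n → P m × Q n)
  both (M , p) (N , q) = M ℕ.⊔ N , λ m n M⊔N≤m M⊔N≤n →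
    p m (ℕ.m⊔n≤o⇒m≤o M N M⊔N≤m) , q n (ℕ.m⊔n≤o⇒n≤o M N M⊔N≤n)

IsCauchy : (ℕ → ℚ) → Set
IsCauchy s = ∀ ε → .{{Positive ε}} → Eventually₂ (λ m n → ∣ s m ℚ.- s n ∣ ℚ.< ε)

-- The reals are Cauchy sequences of rationals, identified up to null
-- sequences by the equivalence _≃_ below.
record ℝ : Set where
  no-eta-equality
  constructor mkℝ
  field
    seq    : ℕ → ℚ
    cauchy : IsCauchy seq

open ℝ public

infix 4 _≃_ _#ʳ_

record _≃_ (x y : ℝ) : Set where
  constructor mk≃
  field
    close : ∀ ε → .{{Positive ε}} → Eventually (λ n → ∣ seq x n ℚ.- seq y n ∣ ℚ.< ε)

open _≃_

-- The constructive reading of x ≠ y: eventually bounded apart.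
_#ʳ_ : ℝ → ℝ → Set
x #ʳ y = ∃[ δ ] (Positive δ × Eventually (λ n → δ ℚ.< ∣ seq x n ℚ.- seq y n ∣))

private
  Bounded : (ℕ → ℚ) → ℚ → Set
  Bounded s B = Eventually (λ n → ∣ s n ∣ ℚ.< B)

  bounded : ∀ x → ∃[ B ] (Positive B × Bounded (seq x) B)
  bounded x = fromBound (cauchy x 1ℚ)
    where
    fromBound : Eventually₂ (λ m n → ∣ seq x m ℚ.- seq x n ∣ ℚ.< 1ℚ) →
                ∃[ B ] (Positive B × Bounded (seq x) B)
    fromBound (N , p) =
        1ℚ ℚ.+ ∣ seq x N ∣
      , ℚ.pos+nonNeg⇒pos 1ℚ (∣ seq x N ∣) {{ℚ.∣-∣-nonNeg (seq x N)}}
      , N , λ n N≤n → bound {seq x n} (p n N N≤n ℕ.≤-refl)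

  commonBound : ∀ x y → ∃[ B ] (Positive B × Bounded (seq x) B × Bounded (seq y) B)
  commonBound x y = join (bounded x) (bounded y)
    where
    join : ∃[ B ] (Positive B × Bounded (seq x) B) →
           ∃[ C ] (Positive C × Bounded (seq y) C) →
           ∃[ D ] (Positive D × Bounded (seq x) D × Bounded (seq y) D)
    join (B , B>0 , p) (C , C>0 , q) =
        B ℚ.+ C
      , ℚ.pos+pos⇒pos B {{B>0}} C {{C>0}}
      , map (λ n → <-+ʳ {∣ seq x n ∣} B C {{C>0}}) p
      , map (λ n → <-+ˡ {∣ seq y n ∣} B C {{B>0}}) q

≡⇒≃ : ∀ {x y} → (∀ n → seq x n ≡ seq y n) → x ≃ y
≡⇒≃ {x} {y} eq .close ε = 0 , λ n _ →
  subst (λ q → ∣ seq x n ℚ.- q ∣ ℚ.< ε) (eq n) (∣p-p∣<ε (seq x n) ε)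

fromℚʳ : ℚ → ℝ
fromℚʳ q .seq _      = q
fromℚʳ q .cauchy ε = 0 , λ _ _ _ _ → ∣p-p∣<ε q ε

0ʳ 1ʳ : ℝ
0ʳ = fromℚʳ 0ℚ
1ʳ = fromℚʳ 1ℚ

infixl 6 _+ʳ_
infixl 7 _*ʳ_
infix  8 -ʳ_

_+ʳ_ : ℝ → ℝ → ℝ
(x +ʳ y) .seq n = seq x n ℚ.+ seq y n
(x +ʳ y) .cauchy ε = zipWith₂
  (λ m n p q → subst (_ ℚ.<_) (halves ε)
    (+-close {seq x m} {seq x n} {seq y m} {seq y n} p q))
  (cauchy x (½ ℚ.* ε) {{ℚ.pos*pos⇒pos ½ ε}})
  (cauchy y (½ ℚ.* ε) {{ℚ.pos*pos⇒pos ½ ε}})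

-ʳ_ : ℝ → ℝ
(-ʳ x) .seq n = ℚ.- seq x n
(-ʳ x) .cauchy ε = map₂ (λ m n → neg-close {seq x m} {seq x n}) (cauchy x ε)

_*ʳ_ : ℝ → ℝ → ℝ
(x *ʳ y) .seq n = seq x n ℚ.* seq y n
(x *ʳ y) .cauchy ε = go (commonBound x y)
  where
  go : ∃[ B ] (Positive B × Bounded (seq x) B × Bounded (seq y) B) →
       Eventually₂ (λ m n → ∣ seq x m ℚ.* seq y m ℚ.- seq x n ℚ.* seq y n ∣ ℚ.< ε)
  go (B , B>0 , x<B , y<B) = zipWith₂
    (λ m n (xm<B , yn<B) (p , q) →
      *-close {seq x m} {seq x n} {seq y m} {seq y n} B ε {{B>0}} xm<B yn<B p q)
    (both x<B y<B)
    (zipWith₂ (λ _ _ → _,_)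
      (cauchy x (shrink B ε {{B>0}}) {{shrink-pos B ε {{B>0}} }})
      (cauchy y (shrink B ε {{B>0}}) {{shrink-pos B ε {{B>0}} }}))

recipʳ : (x : ℝ) → x #ʳ 0ʳ → ℝ
recipʳ x _ .seq n = recip (seq x n)
recipʳ x (δ , δ>0 , d) .cauchy ε = zipWith₂
  (λ m n (xm>δ , xn>δ) → recip-close {seq x m} {seq x n} δ ε {{δ>0}} xm>δ xn>δ)
  (both far far)
  (cauchy x (ε ℚ.* (δ ℚ.* δ))
    {{ℚ.pos*pos⇒pos ε (δ ℚ.* δ) {{ℚ.pos*pos⇒pos δ {{δ>0}} δ {{δ>0}} }} }})
  where
  far : Eventually (λ n → δ ℚ.< ∣ seq x n ∣)
  far = map (λ n → subst (λ q → δ ℚ.< ∣ q ∣) (p-0≡p (seq x n))) d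

≃-refl : ∀ {x} → x ≃ x
≃-refl = ≡⇒≃ (λ _ → refl)

≃-sym : ∀ {x y} → x ≃ y → y ≃ x
≃-sym {x} {y} x≃y .close ε = map
  (λ n → subst (ℚ._< ε) (∣-∣-sym (seq x n) (seq y n))) (close x≃y ε)

≃-trans : ∀ {x y z} → x ≃ y → y ≃ z → x ≃ z
≃-trans {x} {y} {z} x≃y y≃z .close ε = zipWith
  (λ n p q → subst (_ ℚ.<_) (halves ε) (trans-close {seq x n} {seq y n} {seq z n} p q))
  (close x≃y (½ ℚ.* ε) {{ℚ.pos*pos⇒pos ½ ε}})
  (close y≃z (½ ℚ.* ε) {{ℚ.pos*pos⇒pos ½ ε}})

+ʳ-cong : ∀ {x x′ y y′} → x ≃ x′ → y ≃ y′ → x +ʳ y ≃ x′ +ʳ y′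
+ʳ-cong {x} {x′} {y} {y′} x≃x′ y≃y′ .close ε = zipWith
  (λ n p q → subst (_ ℚ.<_) (halves ε)
    (+-close {seq x n} {seq x′ n} {seq y n} {seq y′ n} p q))
  (close x≃x′ (½ ℚ.* ε) {{ℚ.pos*pos⇒pos ½ ε}})
  (close y≃y′ (½ ℚ.* ε) {{ℚ.pos*pos⇒pos ½ ε}})

-ʳ-cong : ∀ {x y} → x ≃ y → -ʳ x ≃ -ʳ y
-ʳ-cong {x} {y} x≃y .close ε = map (λ n → neg-close {seq x n}) (close x≃y ε)

*ʳ-cong : ∀ {x x′ y y′} → x ≃ x′ → y ≃ y′ → x *ʳ y ≃ x′ *ʳ y′
*ʳ-cong {x} {x′} {y} {y′} x≃x′ y≃y′ .close ε = go (commonBound x y′)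
  where
  go : ∃[ B ] (Positive B × Bounded (seq x) B × Bounded (seq y′) B) →
       Eventually (λ n → ∣ seq x n ℚ.* seq y n ℚ.- seq x′ n ℚ.* seq y′ n ∣ ℚ.< ε)
  go (B , B>0 , x<B , y′<B) = zipWith
    (λ n (xn<B , y′n<B) (p , q) →
      *-close {seq x n} {seq x′ n} {seq y n} {seq y′ n} B ε {{B>0}} xn<B y′n<B p q)
    (zipWith (λ _ → _,_) x<B y′<B)
    (zipWith (λ _ → _,_)
      (close x≃x′ (shrink B ε {{B>0}}) {{shrink-pos B ε {{B>0}} }})
      (close y≃y′ (shrink B ε {{B>0}}) {{shrink-pos B ε {{B>0}} }}))

*ʳ-inverse : ∀ x (x#0 : x #ʳ 0ʳ) → x *ʳ recipʳ x x#0 ≃ 1ʳ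
*ʳ-inverse x (δ , δ>0 , d) .close ε = map
  (λ n δ<x → subst (λ q → ∣ q ℚ.- 1ℚ ∣ ℚ.< ε)
    (sym (*-recip (apart⇒≢0 {{δ>0}} (subst (λ q → δ ℚ.< ∣ q ∣) (p-0≡p (seq x n)) δ<x))))
    (∣p-p∣<ε 1ℚ ε))
  d

record ℂ : Set where
  constructor _+i_
  field
    re im : ℝ

open ℂ public

infix 4 _≈_ _#_

record _≈_ (z w : ℂ) : Set where
  constructor _,_
  field
    re≃ : re z ≃ re w
    im≃ : im z ≃ im w

-- The constructive reading of z ≠ w.
_#_ : ℂ → ℂ → Set
z # w = re z #ʳ re w ⊎ im z #ʳ im w

infixl 6 _+_
infixl 7 _*_
infix  8 -_

fromℚ : ℚ → ℂ
fromℚ q = fromℚʳ q +i 0ʳ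

0ᶜ 1ᶜ : ℂ
0ᶜ = fromℚ 0ℚ
1ᶜ = fromℚ 1ℚ

_+_ : ℂ → ℂ → ℂ
(a +i b) + (c +i d) = (a +ʳ c) +i (b +ʳ d)

-_ : ℂ → ℂ
- (a +i b) = (-ʳ a) +i (-ʳ b)

_*_ : ℂ → ℂ → ℂ
(a +i b) * (c +i d) = (a *ʳ c +ʳ -ʳ (b *ʳ d)) +i (a *ʳ d +ʳ b *ʳ c)

normSq : ℂ → ℝ
normSq (a +i b) = a *ʳ a +ʳ b *ʳ b

normSq#0 : ∀ z → z # 0ᶜ → normSq z #ʳ 0ʳ
normSq#0 (a +i b) (inj₁ (δ , δ>0 , d)) =
  δ ℚ.* δ , ℚ.pos*pos⇒pos δ {{δ>0}} δ {{δ>0}} , map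
    (λ n δ<a → subst (λ q → δ ℚ.* δ ℚ.< ∣ q ∣) (sym (p-0≡p _))
      (δ²<∣p*p+q*q∣ {seq a n} {seq b n} {{δ>0}}
        (subst (λ q → δ ℚ.< ∣ q ∣) (p-0≡p (seq a n)) δ<a)))
    d
normSq#0 (a +i b) (inj₂ (δ , δ>0 , d)) =
  δ ℚ.* δ , ℚ.pos*pos⇒pos δ {{δ>0}} δ {{δ>0}} , map
    (λ n δ<b → subst (λ q → δ ℚ.* δ ℚ.< ∣ q ∣)
      (trans (ℚ.+-comm (seq b n ℚ.* seq b n) _) (sym (p-0≡p _)))
      (δ²<∣p*p+q*q∣ {seq b n} {seq a n} {{δ>0}}
        (subst (λ q → δ ℚ.< ∣ q ∣) (p-0≡p (seq b n)) δ<b)))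
    d

-- 1/(a + ib) = (a - ib)/(a² + b²)
recipᶜ : (z : ℂ) → z # 0ᶜ → ℂ
recipᶜ z z#0 = (re z *ʳ r) +i (-ʳ (im z *ʳ r))
  where r = recipʳ (normSq z) (normSq#0 z z#0)

private
  open +-*-Solver using (solve; con; _:=_; _:+_; _:*_; :-_)

  *-assoc : ∀ x y z → (x * y) * z ≈ x * (y * z)
  *-assoc x y z =
      ≡⇒≃ (λ n → solve 6 (λ a b c d e f →
        (a :* c :+ :- (b :* d)) :* e :+ :- ((a :* d :+ b :* c) :* f) :=
        a :* (c :* e :+ :- (d :* f)) :+ :- (b :* (c :* f :+ d :* e))) refl
        (seq (re x) n) (seq (im x) n) (seq (re y) n) (seq (im y) n)
        (seq (re z) n) (seq (im z) n))
    , ≡⇒≃ (λ n → solve 6 (λ a b c d e f →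
        (a :* c :+ :- (b :* d)) :* f :+ (a :* d :+ b :* c) :* e :=
        a :* (c :* f :+ d :* e) :+ b :* (c :* e :+ :- (d :* f))) refl
        (seq (re x) n) (seq (im x) n) (seq (re y) n) (seq (im y) n)
        (seq (re z) n) (seq (im z) n))

  *-comm : ∀ x y → x * y ≈ y * x
  *-comm x y =
      ≡⇒≃ (λ n → solve 4 (λ a b c d →
        a :* c :+ :- (b :* d) := c :* a :+ :- (d :* b)) refl
        (seq (re x) n) (seq (im x) n) (seq (re y) n) (seq (im y) n))
    , ≡⇒≃ (λ n → solve 4 (λ a b c d →
        a :* d :+ b :* c := c :* b :+ d :* a) refl
        (seq (re x) n) (seq (im x) n) (seq (re y) n) (seq (im y) n))

  *-identityˡ : ∀ x → 1ᶜ * x ≈ x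
  *-identityˡ x =
      ≡⇒≃ (λ n → solve 2 (λ a b → con 1ℚ :* a :+ :- (con 0ℚ :* b) := a) refl
        (seq (re x) n) (seq (im x) n))
    , ≡⇒≃ (λ n → solve 2 (λ a b → con 1ℚ :* b :+ con 0ℚ :* a := b) refl
        (seq (re x) n) (seq (im x) n))

  *-distribʳ-+ : ∀ x y z → (y + z) * x ≈ y * x + z * x
  *-distribʳ-+ x y z =
      ≡⇒≃ (λ n → solve 6 (λ a b c d e f →
        (c :+ e) :* a :+ :- ((d :+ f) :* b) :=
        (c :* a :+ :- (d :* b)) :+ (e :* a :+ :- (f :* b))) refl
        (seq (re x) n) (seq (im x) n) (seq (re y) n) (seq (im y) n)
        (seq (re z) n) (seq (im z) n))
    , ≡⇒≃ (λ n → solve 6 (λ a b c d e f →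
        (c :+ e) :* b :+ (d :+ f) :* a :=
        (c :* b :+ d :* a) :+ (e :* b :+ f :* a)) refl
        (seq (re x) n) (seq (im x) n) (seq (re y) n) (seq (im y) n)
        (seq (re z) n) (seq (im z) n))

  ≈-trans : ∀ {x y z} → x ≈ y → y ≈ z → x ≈ z
  ≈-trans (p , q) (p′ , q′) = ≃-trans p p′ , ≃-trans q q′

  *-cong : ∀ {x x′ y y′} → x ≈ x′ → y ≈ y′ → x * y ≈ x′ * y′
  *-cong (p , q) (p′ , q′) =
      +ʳ-cong (*ʳ-cong p p′) (-ʳ-cong (*ʳ-cong q q′))
    , +ʳ-cong (*ʳ-cong p q′) (*ʳ-cong q p′)

  +-identityˡ : ∀ x → 0ᶜ + x ≈ x
  +-identityˡ x = ≡⇒≃ (λ n → ℚ.+-identityˡ (seq (re x) n))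
                , ≡⇒≃ (λ n → ℚ.+-identityˡ (seq (im x) n))

  +-comm : ∀ x y → x + y ≈ y + x
  +-comm x y = ≡⇒≃ (λ n → ℚ.+-comm (seq (re x) n) (seq (re y) n))
             , ≡⇒≃ (λ n → ℚ.+-comm (seq (im x) n) (seq (im y) n))

  -‿inverseˡ : ∀ x → - x + x ≈ 0ᶜ
  -‿inverseˡ x = ≡⇒≃ (λ n → ℚ.+-inverseˡ (seq (re x) n))
               , ≡⇒≃ (λ n → ℚ.+-inverseˡ (seq (im x) n))

isCommutativeRing : IsCommutativeRing _≈_ _+_ _*_ -_ 0ᶜ 1ᶜ
isCommutativeRing = record
  { isRing = record
    { +-isAbelianGroup = record
      { isGroup = record
        { isMonoid = record
          { isSemigroup = record
            { isMagma = record
              { isEquivalence = record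
                { refl  = ≃-refl , ≃-refl
                ; sym   = λ (p , q) → ≃-sym p , ≃-sym q
                ; trans = ≈-trans
                }
              ; ∙-cong = λ (p , q) (p′ , q′) → +ʳ-cong p p′ , +ʳ-cong q q′
              }
            ; assoc = λ x y z →
                  ≡⇒≃ (λ n → ℚ.+-assoc (seq (re x) n) (seq (re y) n) (seq (re z) n))
                , ≡⇒≃ (λ n → ℚ.+-assoc (seq (im x) n) (seq (im y) n) (seq (im z) n))
            }
          ; identity = +-identityˡ , λ x → ≈-trans (+-comm x 0ᶜ) (+-identityˡ x)
          }
        ; inverse = -‿inverseˡ , λ x → ≈-trans (+-comm x (- x)) (-‿inverseˡ x)
        ; ⁻¹-cong = λ (p , q) → -ʳ-cong p , -ʳ-cong q
        }
      ; comm = +-comm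
      }
    ; *-cong = *-cong
    ; *-assoc = *-assoc
    ; *-identity = *-identityˡ , λ x → ≈-trans (*-comm x 1ᶜ) (*-identityˡ x)
    ; distrib = (λ x y z → ≈-trans (*-comm x (y + z)) (≈-trans (*-distribʳ-+ x y z)
                    ( +ʳ-cong (_≈_.re≃ (*-comm y x)) (_≈_.re≃ (*-comm z x))
                    , +ʳ-cong (_≈_.im≃ (*-comm y x)) (_≈_.im≃ (*-comm z x)))))
              , *-distribʳ-+
    }
  ; *-comm = *-comm
  }

ℂ-commutativeRing : CommutativeRing 0ℓ 0ℓ
ℂ-commutativeRing = record { isCommutativeRing = isCommutativeRing }

private module ℂR = CommutativeRing ℂ-commutativeRing

*-inverse : ∀ z (z#0 : z # 0ᶜ) → z * recipᶜ z z#0 ≈ 1ᶜ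
*-inverse z z#0 =
    ≃-trans
      (≡⇒≃ {y = normSq z *ʳ r} (λ n → solve 3 (λ a b r →
        a :* (a :* r) :+ :- (b :* :- (b :* r)) := (a :* a :+ b :* b) :* r) refl
        (seq (re z) n) (seq (im z) n) (seq r n)))
      (*ʳ-inverse (normSq z) (normSq#0 z z#0))
  , ≡⇒≃ (λ n → solve 3 (λ a b r →
      a :* :- (b :* r) :+ b :* (a :* r) := con 0ℚ) refl
      (seq (re z) n) (seq (im z) n) (seq r n))
  where r = recipʳ (normSq z) (normSq#0 z z#0)

open import Algebra.Properties.Monoid.Sum ℂR.+-monoid public
  using (sum; sum-syntax; sum⁺-syntax)

infixl 10 sum₁-syntax

sum₁-syntax : (n : ℕ) → (ℕ → ℂ) → ℂ
sum₁-syntax n t = ∑[ i < n ] t (suc (toℕ i))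

syntax sum₁-syntax n (λ m → e) = ∑[1≤ m ≤ n ] e

PowerSeries : Set
PowerSeries = ℕ → ℂ

infix 9 [x^_]_

[x^_]_ : ℕ → PowerSeries → ℂ
[x^ k ] g = g k

infix 4 _≈ₚ_

_≈ₚ_ : PowerSeries → PowerSeries → Set
f ≈ₚ g = ∀ k → [x^ k ] f ≈ [x^ k ] g

infixl 6 _+ₚ_
infixl 7 _*ₚ_

_+ₚ_ : PowerSeries → PowerSeries → PowerSeries
(f +ₚ g) k = f k + g k

_*ₚ_ : PowerSeries → PowerSeries → PowerSeries
(f *ₚ g) k = ∑[ i ≤ k ] (f (toℕ i) * g (k ∸ toℕ i))

0ₚ 1ₚ : PowerSeries
0ₚ _ = 0ᶜ
1ₚ zero    = 1ᶜ
1ₚ (suc _) = 0ᶜ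

rawSemiring : RawSemiring 0ℓ 0ℓ
rawSemiring = record { _≈_ = _≈ₚ_; _+_ = _+ₚ_; _*_ = _*ₚ_; 0# = 0ₚ; 1# = 1ₚ }

open import Algebra.Definitions.RawSemiring rawSemiring public using (_^_)

-- The coefficients gₙ , gₙ₋₁ , … , g₀ of g = 1/f, from g₀ = 1/c₀ and
-- gₙ₊₁ = -(1/c₀)(c₁gₙ + c₂gₙ₋₁ + ⋯ + cₙ₊₁g₀).
inverseCoeffs : (f : PowerSeries) → [x^ 0 ] f # 0ᶜ → (n : ℕ) → Vector ℂ (suc n)
inverseCoeffs f c₀#0 zero    = recipᶜ (f 0) c₀#0 ∷ []
inverseCoeffs f c₀#0 (suc n) =
  - (recipᶜ (f 0) c₀#0 * ∑[ i ≤ n ] (f (suc (toℕ i)) * inverseCoeffs f c₀#0 n i))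
  ∷ inverseCoeffs f c₀#0 n

inverse : (f : PowerSeries) → [x^ 0 ] f # 0ᶜ → PowerSeries
inverse f c₀#0 n = head (inverseCoeffs f c₀#0 n)

*ₚ-inverse : ∀ f (c₀#0 : [x^ 0 ] f # 0ᶜ) → f *ₚ inverse f c₀#0 ≈ₚ 1ₚ
*ₚ-inverse f c₀#0 zero = ≈-trans (ℂR.+-identityʳ _) (*-inverse (f 0) c₀#0)
*ₚ-inverse f c₀#0 (suc n) = begin
  f 0 * - (r * S) + ∑[ i ≤ n ] (f (suc (toℕ i)) * g (n ∸ toℕ i))
    ≡⟨ cong (f 0 * - (r * S) +_) (sum-cong-≗ {suc n} λ i →
         cong (f (suc (toℕ i)) *_) (coeffs n i)) ⟨
  f 0 * - (r * S) + S      ≈⟨ ℂR.+-congʳ (-‿distribʳ-* (f 0) (r * S)) ⟨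
  - (f 0 * (r * S)) + S    ≈⟨ ℂR.+-congʳ (ℂR.-‿cong (ℂR.*-assoc (f 0) r S)) ⟨
  - (f 0 * r * S) + S      ≈⟨ ℂR.+-congʳ (ℂR.-‿cong (ℂR.*-congʳ (*-inverse (f 0) c₀#0))) ⟩
  - (1ᶜ * S) + S           ≈⟨ ℂR.+-congʳ (ℂR.-‿cong (ℂR.*-identityˡ S)) ⟩
  - S + S                  ≈⟨ ℂR.-‿inverseˡ S ⟩
  0ᶜ                       ∎
  where
  open ≈-Reasoning ℂR.setoid
  open import Algebra.Properties.Ring ℂR.ring using (-‿distribʳ-*)
  open import Algebra.Properties.Monoid.Sum ℂR.+-monoid using (sum-cong-≗)
  g = inverse f c₀#0
  r = recipᶜ (f 0) c₀#0
  S = ∑[ i ≤ n ] (f (suc (toℕ i)) * inverseCoeffs f c₀#0 n i)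

  coeffs : ∀ n (i : Fin (suc n)) → inverseCoeffs f c₀#0 n i ≡ g (n ∸ toℕ i)
  coeffs zero    Fin.zero    = refl
  coeffs (suc n) Fin.zero    = refl
  coeffs (suc n) (Fin.suc i) = coeffs n i

{-# OPTIONS --safe #-}

-- Put P = x f and g = 1/f.  The first condition says a = A b with
-- Aₘₖ = m [xᵐ] Pᵏ = [xᵐ] θ(Pᵏ), where θ = x d/dx, and the second one says
-- n bₙ = (C a)ₙ with Cₙₘ = [xⁿ⁻ᵐ] gⁿ.  Hence (C A)ₙₖ = [xⁿ] gⁿ θ(Pᵏ), and
-- gⁿ θ(Pᵏ) = k xᵏ gᴺ (1 + g θf) for N = n - k.  Since θ(gᴺ) = - N gᴺ⁺¹ θf,
-- the coefficient of xᴺ in gᴺ (1 + g θf) is [N = 0], so C A = diag(n).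
-- As C is triangular with invertible diagonal, it is injective, so A
-- recovers a from b as well.

module Submission where

open import Algebra.Bundles using (CommutativeMonoid; CommutativeRing; CommutativeSemiring)
import Algebra.Construct.Pointwise as Pointwise
import Algebra.Properties.AbelianGroup as AbelianGroupProperties
import Algebra.Properties.CommutativeSemigroup as CommutativeSemigroupProperties
import Algebra.Properties.CommutativeSemiring.Exp as Exp
import Algebra.Properties.Semiring.Mult as Mult
import Algebra.Properties.Semiring.Sum as Sum
import Algebra.Solver.CommutativeMonoid as CommutativeMonoidSolver
import Algebra.Structures.Biased as Biased
open import Data.Fin.Base using (toℕ)
open import Data.Fin.Properties using (toℕ<n; toℕ≤pred[n])
open import Data.Nat.Base as ℕ using (ℕ; zero; suc; z≤n; s≤s; _≤_; _<_)
open import Data.Nat.Induction using (<-rec)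
import Data.Nat.Properties as ℕ
open import Function.Base using (_∘_)
open import Relation.Binary.PropositionalEquality as ≡ using (_≡_)
import Relation.Binary.Reasoning.Setoid as ≈-Reasoning

module FormalPowerSeries {c ℓ} (R : CommutativeRing c ℓ) where

  open CommutativeRing R
  open Sum semiring
  open Mult semiring using (_×_; ×-congʳ; ×-congˡ; ×-homo-+; ×-comm-*; ×-assoc-*)
  open ≈-Reasoning setoid

  -- Finite sums and natural multiples in a commutative ring.

  sum-zero : ∀ n {t : ℕ → Carrier} → (∀ i → t i ≈ 0#) → ∑[ i < n ] t (toℕ i) ≈ 0#
  sum-zero n t≈0 = trans (sum-cong-≋ {n} (λ i → t≈0 (toℕ i))) (sum-replicate-zero n)

  sum-extend : ∀ {m n} → m ≤ n → (t : ℕ → Carrier) → (∀ i → m ≤ i → t i ≈ 0#) →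
               ∑[ i < n ] t (toℕ i) ≈ ∑[ i < m ] t (toℕ i)
  sum-extend {n = n} z≤n t t≈0 = sum-zero n (λ i → t≈0 i z≤n)
  sum-extend (s≤s m≤n) t t≈0 =
    +-congˡ (sum-extend m≤n (t ∘ suc) (λ i m≤i → t≈0 (suc i) (s≤s m≤i)))

  sum-last : ∀ n (t : ℕ → Carrier) → (∀ i → i < n → t i ≈ 0#) →
             ∑[ i ≤ n ] t (toℕ i) ≈ t n
  sum-last zero    t t≈0 = +-identityʳ (t 0)
  sum-last (suc n) t t≈0 = trans
    (+-cong (t≈0 0 (s≤s z≤n)) (sum-last n (t ∘ suc) (λ i i<n → t≈0 (suc i) (s≤s i<n))))
    (+-identityˡ _)

  ×-zeroʳ : ∀ n → n × 0# ≈ 0#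
  ×-zeroʳ n = trans (sym (sum-replicate n)) (sum-replicate-zero n)

  ×-distrib-sum : ∀ n {k} (t : ℕ → Carrier) →
                  n × (∑[ i < k ] t (toℕ i)) ≈ ∑[ i < k ] (n × t (toℕ i))
  ×-distrib-sum zero    {k} t = sym (sum-replicate-zero k)
  ×-distrib-sum (suc n) {k} t = trans
    (+-congˡ (×-distrib-sum n {k} t))
    (sym (∑-distrib-+ {k} (λ i → t (toℕ i)) (λ i → n × t (toℕ i))))

  -- The commutative semiring of formal power series.

  PowerSeries : Set c
  PowerSeries = ℕ → Carrier

  infix  4 _≈ₚ_
  infixl 6 _+ₚ_
  infixl 7 _*ₚ_ _•_

  _≈ₚ_ : PowerSeries → PowerSeries → Set ℓ
  f ≈ₚ g = ∀ k → f k ≈ g k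

  _+ₚ_ _*ₚ_ : PowerSeries → PowerSeries → PowerSeries
  (f +ₚ g) k = f k + g k
  (f *ₚ g) k = ∑[ i ≤ k ] (f (toℕ i) * g (k ℕ.∸ toℕ i))

  0ₚ 1ₚ : PowerSeries
  0ₚ _ = 0#
  1ₚ zero    = 1#
  1ₚ (suc _) = 0#

  _•_ : Carrier → PowerSeries → PowerSeries
  (x • f) k = x * f k

  -- A coefficient of a product depends only on the coefficients of its factors up to the same
  -- degree. This bounded form allows a series to be replaced by a truncation.
  *ₚ-cong-≤ : ∀ n {f f′ g g′ : PowerSeries} →
              (∀ k → k ≤ n → f k ≈ f′ k) → (∀ k → k ≤ n → g k ≈ g′ k) →
              (f *ₚ g) n ≈ (f′ *ₚ g′) n
  *ₚ-cong-≤ n f≈f′ g≈g′ = sum-cong-≋ {suc n} λ i →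
    *-cong (f≈f′ (toℕ i) (toℕ≤pred[n] i)) (g≈g′ (n ℕ.∸ toℕ i) (ℕ.m∸n≤m n (toℕ i)))

  *ₚ-cong : ∀ {f f′ g g′} → f ≈ₚ f′ → g ≈ₚ g′ → f *ₚ g ≈ₚ f′ *ₚ g′
  *ₚ-cong f≈f′ g≈g′ n = *ₚ-cong-≤ n (λ k _ → f≈f′ k) (λ k _ → g≈g′ k)

  *ₚ-distribʳ-+ₚ : ∀ h f g → (f +ₚ g) *ₚ h ≈ₚ f *ₚ h +ₚ g *ₚ h
  *ₚ-distribʳ-+ₚ h f g n = trans
    (sum-cong-≋ {suc n} (λ i → distribʳ (h (n ℕ.∸ toℕ i)) (f (toℕ i)) (g (toℕ i))))
    (∑-distrib-+ {suc n} (λ i → f (toℕ i) * h (n ℕ.∸ toℕ i))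
                         (λ i → g (toℕ i) * h (n ℕ.∸ toℕ i)))

  •-assoc-*ₚ : ∀ x f g → (x • f) *ₚ g ≈ₚ x • (f *ₚ g)
  •-assoc-*ₚ x f g n = trans
    (sum-cong-≋ {suc n} (λ i → *-assoc x (f (toℕ i)) (g (n ℕ.∸ toℕ i))))
    (sym (*-distribˡ-sum {suc n} x (λ i → f (toℕ i) * g (n ℕ.∸ toℕ i))))

  *ₚ-zeroˡ : ∀ f → 0ₚ *ₚ f ≈ₚ 0ₚ
  *ₚ-zeroˡ f n = sum-zero (suc n) {λ i → 0# * f (n ℕ.∸ i)} (λ i → zeroˡ _)

  *ₚ-identityˡ : ∀ f → 1ₚ *ₚ f ≈ₚ f
  *ₚ-identityˡ f zero    = trans (+-identityʳ _) (*-identityˡ _)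
  *ₚ-identityˡ f (suc n) = trans (+-cong (*-identityˡ _) (*ₚ-zeroˡ f n)) (+-identityʳ _)

  -- The definition of `*ₚ` peels off the first summand by computation. Peeling off the last one is
  -- the mirror image that the induction for `*ₚ-comm` needs.
  *ₚ-unfold-last : ∀ n f g → (f *ₚ g) (suc n) ≈ (f *ₚ (g ∘ suc)) n + f (suc n) * g 0
  *ₚ-unfold-last zero    f g = sym (trans (+-assoc _ _ _) (+-congˡ (+-comm _ _)))
  *ₚ-unfold-last (suc n) f g =
    trans (+-congˡ (*ₚ-unfold-last n (f ∘ suc) g)) (sym (+-assoc _ _ _))

  *ₚ-comm : ∀ f g → f *ₚ g ≈ₚ g *ₚ f
  *ₚ-comm f g zero    = +-congʳ (*-comm _ _)
  *ₚ-comm f g (suc n) = begin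
    f 0 * g (suc n) + ((f ∘ suc) *ₚ g) n  ≈⟨ +-cong (*-comm _ _) (*ₚ-comm (f ∘ suc) g n) ⟩
    g (suc n) * f 0 + (g *ₚ (f ∘ suc)) n  ≈⟨ +-comm _ _ ⟩
    (g *ₚ (f ∘ suc)) n + g (suc n) * f 0  ≈⟨ *ₚ-unfold-last n g f ⟨
    (g *ₚ f) (suc n)                      ∎

  *ₚ-assoc : ∀ f g h → (f *ₚ g) *ₚ h ≈ₚ f *ₚ (g *ₚ h)
  *ₚ-assoc f g h zero = +-congʳ (begin
    (f 0 * g 0 + 0#) * h 0  ≈⟨ *-congʳ (+-identityʳ _) ⟩
    f 0 * g 0 * h 0         ≈⟨ *-assoc _ _ _ ⟩
    f 0 * (g 0 * h 0)       ≈⟨ *-congˡ (+-identityʳ _) ⟨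
    f 0 * (g 0 * h 0 + 0#)  ∎)
  *ₚ-assoc f g h (suc n) = begin
    -- By computation, `(f *ₚ g) ∘ suc` is `f 0 • (g ∘ suc) +ₚ (f ∘ suc) *ₚ g`, so the degree drops
    -- and the induction hypothesis applies to `f ∘ suc`.
    (f 0 * g 0 + 0#) * h (suc n) + ((f 0 • (g ∘ suc) +ₚ (f ∘ suc) *ₚ g) *ₚ h) n
      ≈⟨ +-cong (trans (*-congʳ (+-identityʳ _)) (*-assoc _ _ _))
                (trans (*ₚ-distribʳ-+ₚ h (f 0 • (g ∘ suc)) ((f ∘ suc) *ₚ g) n)
                       (+-cong (•-assoc-*ₚ (f 0) (g ∘ suc) h n) (*ₚ-assoc (f ∘ suc) g h n))) ⟩
    f 0 * (g 0 * h (suc n)) + (f 0 * ((g ∘ suc) *ₚ h) n + ((f ∘ suc) *ₚ (g *ₚ h)) n)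
      ≈⟨ +-assoc _ _ _ ⟨
    f 0 * (g 0 * h (suc n)) + f 0 * ((g ∘ suc) *ₚ h) n + ((f ∘ suc) *ₚ (g *ₚ h)) n
      ≈⟨ +-congʳ (distribˡ _ _ _) ⟨
    (f *ₚ (g *ₚ h)) (suc n) ∎

  powerSeriesSemiring : CommutativeSemiring c ℓ
  powerSeriesSemiring = record
    { _≈_ = _≈ₚ_ ; _+_ = _+ₚ_ ; _*_ = _*ₚ_ ; 0# = 0ₚ ; 1# = 1ₚ
    ; isCommutativeSemiring = Biased.isCommutativeSemiringˡ record
      { +-isCommutativeMonoid = +.isCommutativeMonoid
      ; *-isCommutativeMonoid = Biased.isCommutativeMonoidˡ record
        { isSemigroup = record
          { isMagma = record { isEquivalence = +.isEquivalence ; ∙-cong = *ₚ-cong }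
          ; assoc   = *ₚ-assoc
          }
        ; identityˡ = *ₚ-identityˡ
        ; comm      = *ₚ-comm
        }
      ; distribʳ = *ₚ-distribʳ-+ₚ
      ; zeroˡ    = *ₚ-zeroˡ
      }
    }
    where module + = CommutativeMonoid (Pointwise.commutativeMonoid ℕ +-commutativeMonoid)

  module P = CommutativeSemiring powerSeriesSemiring
  module PR = ≈-Reasoning P.setoid
  open Exp powerSeriesSemiring public using (_^_; ^-congˡ; ^-homo-*; ^-distrib-*)
  open Mult P.semiring public using () renaming
    ( _×_ to _×ₚ_; ×-congʳ to ×ₚ-congʳ; ×-comm-* to ×ₚ-comm-*; ×-assoc-* to ×ₚ-assoc-*)
  open import Algebra.Properties.CommutativeMonoid.Mult P.+-commutativeMonoid public
    using () renaming (×-distrib-+ to ×ₚ-distrib-+ₚ)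

  coeff-×ₚ : ∀ n f k → (n ×ₚ f) k ≡ n × f k
  coeff-×ₚ zero    f k = ≡.refl
  coeff-×ₚ (suc n) f k = ≡.cong (f k +_) (coeff-×ₚ n f k)

  1ₚ^n≈1ₚ : ∀ n → 1ₚ ^ n ≈ₚ 1ₚ
  1ₚ^n≈1ₚ zero    = P.refl
  1ₚ^n≈1ₚ (suc n) = P.trans (P.*-identityˡ (1ₚ ^ n)) (1ₚ^n≈1ₚ n)

  -- The Euler operator, its Leibniz rule and its power rule.

  -- The Euler operator x d/dx.
  θ : PowerSeries → PowerSeries
  θ f k = k × f k

  θ-cong : ∀ {f g} → f ≈ₚ g → θ f ≈ₚ θ g
  θ-cong f≈g k = ×-congʳ k (f≈g k)

  θ-1ₚ : θ 1ₚ ≈ₚ 0ₚ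
  θ-1ₚ zero    = refl
  θ-1ₚ (suc k) = ×-zeroʳ (suc k)

  -- In the summand with index `i`, the weight `n` splits as `i + (n ∸ i)`, one part for each
  -- factor.
  θ-*ₚ : ∀ f g → θ (f *ₚ g) ≈ₚ θ f *ₚ g +ₚ f *ₚ θ g
  θ-*ₚ f g n = begin
    n × (f *ₚ g) n
      ≈⟨ ×-distrib-sum n {suc n} (λ i → f i * g (n ℕ.∸ i)) ⟩
    ∑[ i ≤ n ] (n × (f (toℕ i) * g (n ℕ.∸ toℕ i)))
      ≈⟨ sum-cong-≋ {suc n} (λ i → leibniz (toℕ i) (toℕ≤pred[n] i)) ⟩
    ∑[ i ≤ n ] (θ f (toℕ i) * g (n ℕ.∸ toℕ i) + f (toℕ i) * θ g (n ℕ.∸ toℕ i))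
      ≈⟨ ∑-distrib-+ {suc n} (λ i → θ f (toℕ i) * g (n ℕ.∸ toℕ i))
                                 (λ i → f (toℕ i) * θ g (n ℕ.∸ toℕ i)) ⟩
    (θ f *ₚ g +ₚ f *ₚ θ g) n ∎
    where
    leibniz : ∀ i → i ≤ n →
      n × (f i * g (n ℕ.∸ i)) ≈ θ f i * g (n ℕ.∸ i) + f i * θ g (n ℕ.∸ i)
    leibniz i i≤n = begin
      n × (f i * g (n ℕ.∸ i))
        ≈⟨ ×-congˡ (ℕ.m+[n∸m]≡n i≤n) ⟨
      (i ℕ.+ (n ℕ.∸ i)) × (f i * g (n ℕ.∸ i))
        ≈⟨ ×-homo-+ _ i (n ℕ.∸ i) ⟩
      i × (f i * g (n ℕ.∸ i)) + (n ℕ.∸ i) × (f i * g (n ℕ.∸ i))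
        ≈⟨ +-cong (×-assoc-* i _ _) (×-comm-* (n ℕ.∸ i) _ _) ⟨
      θ f i * g (n ℕ.∸ i) + f i * θ g (n ℕ.∸ i) ∎

  θ-^ : ∀ f k → θ (f ^ suc k) ≈ₚ suc k ×ₚ (f ^ k *ₚ θ f)
  θ-^ f zero = PR.begin
    θ (f *ₚ 1ₚ)             PR.≈⟨ θ-cong (P.*-identityʳ f) ⟩
    θ f                     PR.≈⟨ P.*-identityˡ (θ f) ⟨
    1ₚ *ₚ θ f               PR.≈⟨ P.+-identityʳ (1ₚ *ₚ θ f) ⟨
    1ₚ *ₚ θ f +ₚ 0ₚ         PR.∎
  θ-^ f (suc k) = PR.begin
    θ (f *ₚ f ^ suc k)
      PR.≈⟨ θ-*ₚ f (f ^ suc k) ⟩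
    θ f *ₚ f ^ suc k +ₚ f *ₚ θ (f ^ suc k)
      PR.≈⟨ P.+-cong (P.*-comm (θ f) (f ^ suc k)) (P.*-congˡ {f} (θ-^ f k)) ⟩
    f ^ suc k *ₚ θ f +ₚ f *ₚ (suc k ×ₚ (f ^ k *ₚ θ f))
      PR.≈⟨ P.+-congˡ (×ₚ-comm-* (suc k) f (f ^ k *ₚ θ f)) ⟩
    f ^ suc k *ₚ θ f +ₚ suc k ×ₚ (f *ₚ (f ^ k *ₚ θ f))
      PR.≈⟨ P.+-congˡ (×ₚ-congʳ (suc k) (P.*-assoc f (f ^ k) (θ f))) ⟨
    suc (suc k) ×ₚ (f ^ suc k *ₚ θ f) PR.∎

  -- Multiplication by powers of x.

  infixr 8 X·_ X^_·_

  X·_ : PowerSeries → PowerSeries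
  (X· f) zero    = 0#
  (X· f) (suc k) = f k

  X^_·_ : ℕ → PowerSeries → PowerSeries
  X^ zero  · f = f
  X^ suc k · f = X· X^ k · f

  X·-cong : ∀ {f g} → f ≈ₚ g → X· f ≈ₚ X· g
  X·-cong f≈g zero    = refl
  X·-cong f≈g (suc k) = f≈g k

  X^·-cong : ∀ k {f g} → f ≈ₚ g → X^ k · f ≈ₚ X^ k · g
  X^·-cong zero    f≈g = f≈g
  X^·-cong (suc k) f≈g = X·-cong (X^·-cong k f≈g)

  X·-+ₚ : ∀ f g → X· f +ₚ X· g ≈ₚ X· (f +ₚ g)
  X·-+ₚ f g zero    = +-identityˡ 0#
  X·-+ₚ f g (suc n) = refl

  X^·-+ₚ : ∀ k f g → X^ k · f +ₚ X^ k · g ≈ₚ X^ k · (f +ₚ g)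
  X^·-+ₚ zero    f g = P.refl
  X^·-+ₚ (suc k) f g = P.trans (X·-+ₚ (X^ k · f) (X^ k · g)) (X·-cong (X^·-+ₚ k f g))

  X·-*ₚ : ∀ f g → (X· f) *ₚ g ≈ₚ X· (f *ₚ g)
  X·-*ₚ f g zero    = trans (+-identityʳ _) (zeroˡ _)
  X·-*ₚ f g (suc n) = trans (+-congʳ (zeroˡ _)) (+-identityˡ _)

  X^·-*ₚ : ∀ k f g → (X^ k · f) *ₚ g ≈ₚ X^ k · (f *ₚ g)
  X^·-*ₚ zero    f g = P.refl
  X^·-*ₚ (suc k) f g = P.trans (X·-*ₚ (X^ k · f) g) (X·-cong (X^·-*ₚ k f g))

  coeff-X^· : ∀ k n f → (X^ k · f) (k ℕ.+ n) ≡ f n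
  coeff-X^· zero    n f = ≡.refl
  coeff-X^· (suc k) n f = coeff-X^· k n f

  coeff-X^·-≤ : ∀ {k n} f → k ≤ n → (X^ k · f) n ≡ f (n ℕ.∸ k)
  coeff-X^·-≤ f z≤n       = ≡.refl
  coeff-X^·-≤ f (s≤s k≤n) = coeff-X^·-≤ f k≤n

  coeff-X^·-> : ∀ {k n} f → n < k → (X^ k · f) n ≡ 0#
  coeff-X^·-> {suc k} {zero}  f _         = ≡.refl
  coeff-X^·-> {suc k} {suc n} f (s≤s n<k) = coeff-X^·-> f n<k

  θ-X· : ∀ f → θ (X· f) ≈ₚ X· (f +ₚ θ f)
  θ-X· f zero    = refl
  θ-X· f (suc n) = refl

  θ-X^· : ∀ k f → θ (X^ k · f) ≈ₚ X^ k · (k ×ₚ f +ₚ θ f)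
  θ-X^· zero    f = P.sym (P.+-identityˡ (θ f))
  θ-X^· (suc k) f = PR.begin
    θ (X· X^ k · f)                              PR.≈⟨ θ-X· (X^ k · f) ⟩
    X· (X^ k · f +ₚ θ (X^ k · f))                PR.≈⟨ X·-cong (P.+-congˡ (θ-X^· k f)) ⟩
    X· (X^ k · f +ₚ X^ k · (k ×ₚ f +ₚ θ f))      PR.≈⟨ X·-cong (X^·-+ₚ k f (k ×ₚ f +ₚ θ f)) ⟩
    X^ suc k · (f +ₚ (k ×ₚ f +ₚ θ f))            PR.≈⟨ X^·-cong (suc k) (P.+-assoc f (k ×ₚ f) (θ f)) ⟨
    X^ suc k · (suc k ×ₚ f +ₚ θ f)               PR.∎

  -- Convolution with `w` is triangular: once the lower coefficients agree, the two sides can differ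
  -- only in the term with `w 0`, and `u` inverts `w 0`.
  *ₚ-cancel : ∀ {u w} → u * w 0 ≈ 1# → ∀ {h h′} n → (∀ m → m < n → h m ≈ h′ m) →
              (w *ₚ h) n ≈ (w *ₚ h′) n → h n ≈ h′ n
  *ₚ-cancel {u} {w} uw₀≈1 {h} {h′} n below eq = begin
    h n              ≈⟨ unit (h n) ⟨
    u * (w 0 * h n)  ≈⟨ *-congˡ (leading n below eq) ⟩
    u * (w 0 * h′ n) ≈⟨ unit (h′ n) ⟩
    h′ n             ∎
    where
    unit : ∀ x → u * (w 0 * x) ≈ x
    unit x = trans (sym (*-assoc _ _ _)) (trans (*-congʳ uw₀≈1) (*-identityˡ x))

    open AbelianGroupProperties +-abelianGroup using (∙-cancelʳ)

    leading : ∀ n → (∀ m → m < n → h m ≈ h′ m) →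
              (w *ₚ h) n ≈ (w *ₚ h′) n → w 0 * h n ≈ w 0 * h′ n
    leading zero    below eq = ∙-cancelʳ 0# _ _ eq
    leading (suc n) below eq = ∙-cancelʳ (((w ∘ suc) *ₚ h) n) _ _
      (trans eq (+-congˡ (*ₚ-cong-≤ n {w ∘ suc} (λ _ _ → refl) (λ m m≤n →
         sym (below m (s≤s m≤n))))))

  -- Inverse series and the vanishing coefficient behind Lagrange inversion.

  module LagrangeInversion
    (torsionFree : ∀ n {x y} → suc n × x ≈ suc n × y → x ≈ y)
    (f g : PowerSeries) (f*g≈1 : f *ₚ g ≈ₚ 1ₚ)
    where

    open CommutativeMonoidSolver P.*-commutativeMonoid using (solve; _⊕_; _⊜_)

    -- Apply `θ` to f g = 1 and multiply by `g`. This is θg = - g² θf, written as a vanishing sum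
    -- because series are handled as a semiring, without subtraction.
    θ-inverse : θ g +ₚ g *ₚ (g *ₚ θ f) ≈ₚ 0ₚ
    θ-inverse = PR.begin
      θ g +ₚ g *ₚ (g *ₚ θ f)
        PR.≈⟨ P.+-congʳ (P.*-identityˡ (θ g)) ⟨
      1ₚ *ₚ θ g +ₚ g *ₚ (g *ₚ θ f)
        PR.≈⟨ P.+-congʳ (P.*-congʳ {θ g} f*g≈1) ⟨
      f *ₚ g *ₚ θ g +ₚ g *ₚ (g *ₚ θ f)
        PR.≈⟨ P.+-cong (solve 3 (λ f g h → (f ⊕ g) ⊕ h ⊜ g ⊕ (f ⊕ h)) P.refl f g (θ g))
                       (P.*-congˡ {g} (P.*-comm g (θ f))) ⟩
      g *ₚ (f *ₚ θ g) +ₚ g *ₚ (θ f *ₚ g)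
        PR.≈⟨ P.distribˡ g (f *ₚ θ g) (θ f *ₚ g) ⟨
      g *ₚ (f *ₚ θ g +ₚ θ f *ₚ g)
        PR.≈⟨ P.*-congˡ {g} (P.+-comm (f *ₚ θ g) (θ f *ₚ g)) ⟩
      g *ₚ (θ f *ₚ g +ₚ f *ₚ θ g)
        PR.≈⟨ P.*-congˡ {g} (θ-*ₚ f g) ⟨
      g *ₚ θ (f *ₚ g)
        PR.≈⟨ P.*-congˡ {g} (P.trans (θ-cong f*g≈1) θ-1ₚ) ⟩
      g *ₚ 0ₚ
        PR.≈⟨ P.zeroʳ g ⟩
      0ₚ PR.∎

    f^k*g^k≈1 : ∀ k → f ^ k *ₚ g ^ k ≈ₚ 1ₚ
    f^k*g^k≈1 k = P.trans (P.sym (^-distrib-* f g k))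
                          (P.trans (^-congˡ k f*g≈1) (1ₚ^n≈1ₚ k))

    -- The left factor is `θ (P^ (suc k))` stripped of (k + 1) xᵏ⁺¹. All of fᵏ cancels against gᵏ,
    -- and the one further factor `g` either meets the last `f` or stays beside `θ f`.
    cancel-powers : ∀ N k → (f ^ suc k +ₚ f ^ k *ₚ θ f) *ₚ g ^ (N ℕ.+ suc k) ≈ₚ
                            g ^ N +ₚ g ^ N *ₚ (g *ₚ θ f)
    cancel-powers N k = PR.begin
      (f *ₚ f ^ k +ₚ f ^ k *ₚ θ f) *ₚ g ^ (N ℕ.+ suc k)
        PR.≈⟨ P.*-cong (P.+-congʳ {f ^ k *ₚ θ f} (P.*-comm f (f ^ k))) (^-homo-* g N (suc k)) ⟩
      (f ^ k *ₚ f +ₚ f ^ k *ₚ θ f) *ₚ (g ^ N *ₚ (g *ₚ g ^ k))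
        PR.≈⟨ P.distribʳ (g ^ N *ₚ (g *ₚ g ^ k)) (f ^ k *ₚ f) (f ^ k *ₚ θ f) ⟩
      f ^ k *ₚ f *ₚ (g ^ N *ₚ (g *ₚ g ^ k)) +ₚ f ^ k *ₚ θ f *ₚ (g ^ N *ₚ (g *ₚ g ^ k))
        PR.≈⟨ P.+-cong (absorb f) (absorb (θ f)) ⟩
      g ^ N *ₚ (g *ₚ f) +ₚ g ^ N *ₚ (g *ₚ θ f)
        PR.≈⟨ P.+-congʳ (P.*-congˡ {g ^ N} (P.trans (P.*-comm g f) f*g≈1)) ⟩
      g ^ N *ₚ 1ₚ +ₚ g ^ N *ₚ (g *ₚ θ f)
        PR.≈⟨ P.+-congʳ (P.*-identityʳ (g ^ N)) ⟩
      g ^ N +ₚ g ^ N *ₚ (g *ₚ θ f) PR.∎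
      where
      absorb : ∀ h → f ^ k *ₚ h *ₚ (g ^ N *ₚ (g *ₚ g ^ k)) ≈ₚ g ^ N *ₚ (g *ₚ h)
      absorb h = PR.begin
        f ^ k *ₚ h *ₚ (g ^ N *ₚ (g *ₚ g ^ k))
          PR.≈⟨ solve 5 (λ a h b g d → (a ⊕ h) ⊕ (b ⊕ (g ⊕ d)) ⊜ (a ⊕ d) ⊕ (b ⊕ (g ⊕ h)))
                  P.refl (f ^ k) h (g ^ N) g (g ^ k) ⟩
        f ^ k *ₚ g ^ k *ₚ (g ^ N *ₚ (g *ₚ h))
          PR.≈⟨ P.*-congʳ {g ^ N *ₚ (g *ₚ h)} (f^k*g^k≈1 k) ⟩
        1ₚ *ₚ (g ^ N *ₚ (g *ₚ h))
          PR.≈⟨ P.*-identityˡ (g ^ N *ₚ (g *ₚ h)) ⟩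
        g ^ N *ₚ (g *ₚ h) PR.∎

    -- The exponent and the degree are the same `N`. Hence for N > 0, multiplying the coefficient by
    -- `N` turns gᴺ into θ(gᴺ), and the resulting series θ(gᴺ) + N gᴺ⁺¹ θf vanishes in every degree.
    -- `torsionFree` then divides by `N`.
    coeff-N : ∀ N → (g ^ N +ₚ g ^ N *ₚ (g *ₚ θ f)) N ≈ 1ₚ N
    coeff-N zero = begin
      1# + (1ₚ *ₚ (g *ₚ θ f)) 0  ≈⟨ +-congˡ (*ₚ-identityˡ (g *ₚ θ f) 0) ⟩
      -- The constant coefficient of `θ f` is `0 × f 0`, which computes to `0#`.
      1# + (g 0 * 0# + 0#)       ≈⟨ +-congˡ (trans (+-identityʳ _) (zeroʳ _)) ⟩
      1# + 0#                    ≈⟨ +-identityʳ 1# ⟩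
      1#                         ∎
    coeff-N (suc M) = torsionFree M (begin
      N × (g ^ N +ₚ g ^ N *ₚ (g *ₚ θ f)) N
        ≈⟨ ×-distrib-+ _ _ N ⟩
      θ (g ^ N) N + N × (g ^ N *ₚ (g *ₚ θ f)) N
        ≡⟨ ≡.cong (θ (g ^ N) N +_) (coeff-×ₚ N (g ^ N *ₚ (g *ₚ θ f)) N) ⟨
      (θ (g ^ N) +ₚ N ×ₚ (g ^ N *ₚ (g *ₚ θ f))) N
        ≈⟨ vanishes N ⟩
      0#
        ≈⟨ ×-zeroʳ N ⟨
      N × 0# ∎)
      where
      open import Algebra.Properties.CommutativeMonoid.Mult +-commutativeMonoid
        using (×-distrib-+)
      N = suc M

      vanishes : θ (g ^ N) +ₚ N ×ₚ (g ^ N *ₚ (g *ₚ θ f)) ≈ₚ 0ₚ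
      -- The power rule gives θ(gᴺ) = N gᴹ θg, so N gᴹ factors out and leaves the sum in
      -- `θ-inverse`.
      vanishes = PR.begin
        θ (g ^ N) +ₚ N ×ₚ (g ^ N *ₚ (g *ₚ θ f))
          PR.≈⟨ P.+-cong {θ (g ^ N)} (θ-^ g M) (×ₚ-congʳ N
                  (solve 3 (λ g h u → (g ⊕ h) ⊕ u ⊜ h ⊕ (g ⊕ u)) P.refl g (g ^ M) (g *ₚ θ f))) ⟩
        N ×ₚ (g ^ M *ₚ θ g) +ₚ N ×ₚ (g ^ M *ₚ (g *ₚ (g *ₚ θ f)))
          PR.≈⟨ ×ₚ-distrib-+ₚ (g ^ M *ₚ θ g) (g ^ M *ₚ (g *ₚ (g *ₚ θ f))) N ⟨
        N ×ₚ (g ^ M *ₚ θ g +ₚ g ^ M *ₚ (g *ₚ (g *ₚ θ f)))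
          PR.≈⟨ ×ₚ-congʳ N (P.distribˡ (g ^ M) (θ g) (g *ₚ (g *ₚ θ f))) ⟨
        N ×ₚ (g ^ M *ₚ (θ g +ₚ g *ₚ (g *ₚ θ f)))
          PR.≈⟨ ×ₚ-congʳ N (P.trans (P.*-congˡ {g ^ M} θ-inverse) (P.zeroʳ (g ^ M))) ⟩
        N ×ₚ 0ₚ
          PR.≈⟨ (λ k → trans (reflexive (coeff-×ₚ N 0ₚ k)) (×-zeroʳ N)) ⟩
        0ₚ PR.∎

    -- The coefficients of θ(Pᵏ) gⁿ in degree n.

    P^ : ℕ → PowerSeries
    P^ k = X^ k · f ^ k

    -- The exponent `N ℕ.+ suc k` and the degree `suc k ℕ.+ N` are the same n in two orders: the
    -- first lets gⁿ split off gᴺ, the second lets xᵏ⁺¹ be stripped by computation.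
    coeff-θP^ : ∀ N k → (θ (P^ (suc k)) *ₚ g ^ (N ℕ.+ suc k)) (suc k ℕ.+ N) ≈ suc k × 1ₚ N
    coeff-θP^ N k = begin
      (θ (P^ K) *ₚ w) (K ℕ.+ N)
        ≈⟨ P.*-congʳ {w} (θ-X^· K (f ^ K)) (K ℕ.+ N) ⟩
      ((X^ K · (K ×ₚ f ^ K +ₚ θ (f ^ K))) *ₚ w) (K ℕ.+ N)
        ≈⟨ X^·-*ₚ K (K ×ₚ f ^ K +ₚ θ (f ^ K)) w (K ℕ.+ N) ⟩
      (X^ K · ((K ×ₚ f ^ K +ₚ θ (f ^ K)) *ₚ w)) (K ℕ.+ N)
        ≡⟨ coeff-X^· K N ((K ×ₚ f ^ K +ₚ θ (f ^ K)) *ₚ w) ⟩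
      ((K ×ₚ f ^ K +ₚ θ (f ^ K)) *ₚ w) N
        ≈⟨ P.*-congʳ {w} (P.+-congˡ {K ×ₚ f ^ K} (θ-^ f k)) N ⟩
      ((K ×ₚ f ^ K +ₚ K ×ₚ (f ^ k *ₚ θ f)) *ₚ w) N
        ≈⟨ P.*-congʳ {w} (×ₚ-distrib-+ₚ (f ^ K) (f ^ k *ₚ θ f) K) N ⟨
      ((K ×ₚ (f ^ K +ₚ f ^ k *ₚ θ f)) *ₚ w) N
        ≈⟨ ×ₚ-assoc-* K (f ^ K +ₚ f ^ k *ₚ θ f) w N ⟩
      (K ×ₚ ((f ^ K +ₚ f ^ k *ₚ θ f) *ₚ w)) N
        ≡⟨ coeff-×ₚ K ((f ^ K +ₚ f ^ k *ₚ θ f) *ₚ w) N ⟩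
      K × ((f ^ K +ₚ f ^ k *ₚ θ f) *ₚ w) N
        ≈⟨ ×-congʳ K (trans (cancel-powers N k N) (coeff-N N)) ⟩
      K × 1ₚ N ∎
      where
      K = suc k
      w = g ^ (N ℕ.+ suc k)

    coeff-θP^-diag : ∀ n → (θ (P^ (suc n)) *ₚ g ^ suc n) (suc n) ≈ suc n × 1#
    coeff-θP^-diag n = begin
      (θ (P^ (suc n)) *ₚ g ^ suc n) (suc n)
        ≡⟨ ≡.cong (θ (P^ (suc n)) *ₚ g ^ suc n) (ℕ.+-identityʳ (suc n)) ⟨
      (θ (P^ (suc n)) *ₚ g ^ suc n) (suc n ℕ.+ 0)
        ≈⟨ coeff-θP^ 0 n ⟩
      suc n × 1# ∎

    coeff-θP^-< : ∀ {k n} → k < n → (θ (P^ (suc k)) *ₚ g ^ suc n) (suc n) ≈ 0#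
    coeff-θP^-< {k} {n} k<n = begin
      (θ (P^ (suc k)) *ₚ g ^ suc n) (suc n)
        ≡⟨ ≡.cong₂ (λ p q → (θ (P^ (suc k)) *ₚ g ^ p) q)
             (≡.trans (ℕ.+-suc N k) (≡.cong suc (ℕ.m∸n+n≡m k≤n)))
             (≡.cong suc (ℕ.m+[n∸m]≡n k≤n)) ⟨
      (θ (P^ (suc k)) *ₚ g ^ (N ℕ.+ suc k)) (suc k ℕ.+ N)
        ≈⟨ coeff-θP^ N k ⟩
      suc k × 1ₚ N
        ≈⟨ ×-congʳ (suc k) (1ₚ-pos (ℕ.m<n⇒0<n∸m k<n)) ⟩
      suc k × 0#
        ≈⟨ ×-zeroʳ (suc k) ⟩
      0# ∎
      where
      N   = n ℕ.∸ k
      k≤n = ℕ.<⇒≤ k<n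

      1ₚ-pos : ∀ {m} → 0 < m → 1ₚ m ≈ 0#
      1ₚ-pos {suc m} _ = refl

    -- The triangular operators of the two conditions.

    -- The factor `n` of `A` stays outside the sum, where it acts as `θ`. `C` omits the factor 1/n,
    -- so both operators make sense over a ring without division.
    A C : (ℕ → Carrier) → ℕ → Carrier
    A b n = n × (∑[ i < n ] ((f ^ suc (toℕ i)) (n ℕ.∸ suc (toℕ i)) * b (suc (toℕ i))))
    C a n = ∑[ i < n ] ((g ^ n) (n ℕ.∸ suc (toℕ i)) * a (suc (toℕ i)))

    -- Within one row of `C` all summands use the same power of `g`, so the row is a single
    -- convolution, although the series changes with the row.
    C-as-product : ∀ a n → C a (suc n) ≈ ((a ∘ suc) *ₚ g ^ suc n) n
    C-as-product a n = sum-cong-≋ {suc n} λ i →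
      *-comm ((g ^ suc n) (n ℕ.∸ toℕ i)) (a (suc (toℕ i)))

    C-cong : ∀ {a a′} → (∀ n → a (suc n) ≈ a′ (suc n)) → ∀ n → C a n ≈ C a′ n
    C-cong a≈a′ n = sum-cong-≋ {n} (λ i → *-congˡ (a≈a′ (toℕ i)))

    -- Strong induction on the index: row n + 1 is a convolution with gⁿ⁺¹, whose constant
    -- coefficient is a unit, so `*ₚ-cancel` determines the next entry.
    C-injective : ∀ {a a′} → (∀ n → C a (suc n) ≈ C a′ (suc n)) →
                  ∀ n → a (suc n) ≈ a′ (suc n)
    C-injective {a} {a′} Ca≈Ca′ = <-rec _ λ n below →
      -- The inverse of the constant coefficient is `(f ^ suc n) 0`, read off from fⁿ⁺¹ gⁿ⁺¹ = 1 in
      -- degree 0.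
      *ₚ-cancel {w = g ^ suc n} (trans (sym (+-identityʳ _)) (f^k*g^k≈1 (suc n) 0)) n
        (λ m m<n → below m<n)
        (begin
          (g ^ suc n *ₚ (a ∘ suc)) n   ≈⟨ *ₚ-comm (g ^ suc n) (a ∘ suc) n ⟩
          ((a ∘ suc) *ₚ g ^ suc n) n   ≈⟨ C-as-product a n ⟨
          C a (suc n)                  ≈⟨ Ca≈Ca′ n ⟩
          C a′ (suc n)                 ≈⟨ C-as-product a′ n ⟩
          ((a′ ∘ suc) *ₚ g ^ suc n) n  ≈⟨ *ₚ-comm (g ^ suc n) (a′ ∘ suc) n ⟨
          (g ^ suc n *ₚ (a′ ∘ suc)) n  ∎)

    module _ (b : ℕ → Carrier) where

      -- The partial sums of b₁P + b₂P² + ⋯ stand in for the infinite series.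
      combination : ℕ → PowerSeries
      combination n m = ∑[ i < n ] (P^ (suc (toℕ i)) m * b (suc (toℕ i)))

      -- Since Pᵏ is divisible by xᵏ, the terms with k > m do not reach degree `m`, and every cutoff
      -- n ≥ m gives the same coefficient.
      A-as-θ : ∀ {m n} → m ≤ n → A b m ≈ θ (combination n) m
      A-as-θ {m} {n} m≤n = ×-congʳ m (begin
        ∑[ i < m ] ((f ^ suc (toℕ i)) (m ℕ.∸ suc (toℕ i)) * b (suc (toℕ i)))
          ≈⟨ sum-cong-≋ {m} (λ i → *-congʳ (reflexive
               (coeff-X^·-≤ (f ^ suc (toℕ i)) (toℕ<n i)))) ⟨
        ∑[ i < m ] (P^ (suc (toℕ i)) m * b (suc (toℕ i)))
          ≈⟨ sum-extend m≤n (λ i → P^ (suc i) m * b (suc i)) (λ i m≤i →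
               trans (*-congʳ (reflexive (coeff-X^·-> (f ^ suc i) (s≤s m≤i)))) (zeroˡ _)) ⟨
        combination n m ∎)

      θ-combination-*ₚ : ∀ n w m → (θ (combination n) *ₚ w) m ≈
                         ∑[ i < n ] ((θ (P^ (suc (toℕ i))) *ₚ w) m * b (suc (toℕ i)))
      θ-combination-*ₚ n w m = begin
        ∑[ j ≤ m ] (θ (combination n) (toℕ j) * w (m ℕ.∸ toℕ j))
          ≈⟨ sum-cong-≋ {suc m} (λ j → summand (toℕ j)) ⟩
        ∑[ j ≤ m ] ∑[ i < n ] (θ (P^ (suc (toℕ i))) (toℕ j) * w (m ℕ.∸ toℕ j) * b (suc (toℕ i)))
          ≈⟨ ∑-comm {suc m} {n} (λ j i →
               θ (P^ (suc (toℕ i))) (toℕ j) * w (m ℕ.∸ toℕ j) * b (suc (toℕ i))) ⟩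
        ∑[ i < n ] ∑[ j ≤ m ] (θ (P^ (suc (toℕ i))) (toℕ j) * w (m ℕ.∸ toℕ j) * b (suc (toℕ i)))
          ≈⟨ sum-cong-≋ {n} (λ i → *-distribʳ-sum {suc m} (b (suc (toℕ i)))
               (λ j → θ (P^ (suc (toℕ i))) (toℕ j) * w (m ℕ.∸ toℕ j))) ⟨
        ∑[ i < n ] ((θ (P^ (suc (toℕ i))) *ₚ w) m * b (suc (toℕ i))) ∎
        where
        open CommutativeSemigroupProperties
          (CommutativeMonoid.commutativeSemigroup *-commutativeMonoid) using (xy∙z≈xz∙y)

        summand : ∀ j → θ (combination n) j * w (m ℕ.∸ j) ≈
                  ∑[ i < n ] (θ (P^ (suc (toℕ i))) j * w (m ℕ.∸ j) * b (suc (toℕ i)))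
        summand j = begin
          j × combination n j * w (m ℕ.∸ j)
            ≈⟨ *-congʳ (×-distrib-sum j {n} (λ i → P^ (suc i) j * b (suc i))) ⟩
          (∑[ i < n ] (j × (P^ (suc (toℕ i)) j * b (suc (toℕ i))))) * w (m ℕ.∸ j)
            ≈⟨ *-distribʳ-sum {n} (w (m ℕ.∸ j)) _ ⟩
          ∑[ i < n ] (j × (P^ (suc (toℕ i)) j * b (suc (toℕ i))) * w (m ℕ.∸ j))
            ≈⟨ sum-cong-≋ {n} (λ i →
                 trans (*-congʳ (sym (×-assoc-* j _ _))) (xy∙z≈xz∙y _ _ _)) ⟩
          ∑[ i < n ] (θ (P^ (suc (toℕ i))) j * w (m ℕ.∸ j) * b (suc (toℕ i))) ∎

      -- Row n + 1 of `C` pairs θ(b₁P + b₂P² + ⋯) with gⁿ⁺¹. By linearity it is a combination of the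
      -- coefficients of θ(Pᵏ) gⁿ⁺¹, which vanish off the diagonal.
      C∘A : ∀ n → C (A b) (suc n) ≈ suc n × b (suc n)
      C∘A n = begin
        C (A b) (suc n)
          ≈⟨ C-as-product (A b) n ⟩
        ((A b ∘ suc) *ₚ w) n
          -- Multiplication by x moves the entry with index m from degree m - 1 to degree m, where
          -- it is a coefficient of `θ (combination (suc n))`. In degree 0 both series are `0#`.
          ≈⟨ X·-*ₚ (A b ∘ suc) w (suc n) ⟨
        ((X· (A b ∘ suc)) *ₚ w) (suc n)
          ≈⟨ *ₚ-cong-≤ (suc n) {g = w} truncate (λ _ _ → refl) ⟩
        (θ (combination (suc n)) *ₚ w) (suc n)
          ≈⟨ θ-combination-*ₚ (suc n) w (suc n) ⟩
        ∑[ i ≤ n ] ((θ (P^ (suc (toℕ i))) *ₚ w) (suc n) * b (suc (toℕ i)))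
          ≈⟨ sum-last n (λ i → (θ (P^ (suc i)) *ₚ w) (suc n) * b (suc i))
               (λ i i<n → trans (*-congʳ (coeff-θP^-< i<n)) (zeroˡ _)) ⟩
        (θ (P^ (suc n)) *ₚ w) (suc n) * b (suc n)
          ≈⟨ *-congʳ (coeff-θP^-diag n) ⟩
        suc n × 1# * b (suc n)
          ≈⟨ ×-assoc-* (suc n) 1# (b (suc n)) ⟩
        suc n × (1# * b (suc n))
          ≈⟨ ×-congʳ (suc n) (*-identityˡ _) ⟩
        suc n × b (suc n) ∎
        where
        w = g ^ suc n

        truncate : ∀ k → k ≤ suc n → (X· (A b ∘ suc)) k ≈ θ (combination (suc n)) k
        truncate zero    _   = refl
        truncate (suc k) k≤n = A-as-θ k≤n

    A⇒C : ∀ a b → (∀ n → a (suc n) ≈ A b (suc n)) → ∀ n → suc n × b (suc n) ≈ C a (suc n)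
    A⇒C a b a≈Ab n = trans (sym (C∘A b n)) (C-cong {A b} {a} (λ m → sym (a≈Ab m)) (suc n))

    -- By `C∘A`, both `a` and `A b` are sent by `C` to the sequence n bₙ, so injectivity identifies
    -- them.
    C⇒A : ∀ a b → (∀ n → suc n × b (suc n) ≈ C a (suc n)) → ∀ n → a (suc n) ≈ A b (suc n)
    C⇒A a b nb≈Ca = C-injective {a} {A b} (λ n → trans (sym (nb≈Ca n)) (sym (C∘A b n)))

open import Defs
open import Data.Integer.Base using (+_; 1ℤ)
open import Data.Nat.Base using (ℕ; NonZero; _∸_)
open import Data.Rational.Base using (_/_)
open import Function.Bundles using (_⇔_; mk⇔)
import Data.Integer.Base as ℤ
import Data.Integer.Properties as ℤ
open import Data.Nat.Coprimality using (1-coprimeTo) renaming (sym to coprime-sym)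
open import Data.Rational.Base as ℚ using (mkℚ; 1ℚ)
import Data.Rational.Properties as ℚ

-- Integer and reciprocal scalars in ℂ.

-- For a variable `n`, `_/_` is stuck on a gcd computation; coprimality with 1 exposes the normal
-- form on which rational arithmetic computes.
n/1≡mkℚ : ∀ n → + n / 1 ≡ mkℚ (+ n) 0 (coprime-sym (1-coprimeTo n))
n/1≡mkℚ n = ℚ.normalize-coprime (coprime-sym (1-coprimeTo n))

[1+n]/1≡1+n/1 : ∀ n → + suc n / 1 ≡ 1ℚ ℚ.+ + n / 1
[1+n]/1≡1+n/1 n rewrite n/1≡mkℚ n =
  ≡.cong (_/ 1) (≡.cong (λ k → 1ℤ ℤ.+ k) (≡.sym (ℤ.*-identityʳ (+ n))))

1/n*n≡1 : ∀ n → (1ℤ / suc n) ℚ.* (+ suc n / 1) ≡ 1ℚ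
1/n*n≡1 n = ≡.trans
  (≡.cong₂ ℚ._*_ (ℚ.normalize-coprime (1-coprimeTo (suc n))) (n/1≡mkℚ (suc n)))
  (ℚ.*-inverseˡ (mkℚ (+ suc n) 0 (coprime-sym (1-coprimeTo (suc n)))))

private
  module ℂR = CommutativeRing ℂ-commutativeRing
  module F = FormalPowerSeries ℂ-commutativeRing
open Mult ℂR.semiring using (_×_; ×-congʳ; ×-assoc-*)
open Sum ℂR.semiring using (sum-cong-≋)
open ≈-Reasoning ℂR.setoid

fromℚ-+ : ∀ p q → fromℚ (p ℚ.+ q) ≈ fromℚ p + fromℚ q
fromℚ-+ p q = ≡⇒≃ (λ _ → ≡.refl) , ≡⇒≃ (λ _ → ≡.refl)

fromℚ-* : ∀ p q → fromℚ (p ℚ.* q) ≈ fromℚ p * fromℚ q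
fromℚ-* p q =
    ≡⇒≃ (λ _ → ≡.sym (ℚ.+-identityʳ (p ℚ.* q)))
  , ≡⇒≃ (λ _ → ≡.sym (≡.cong₂ ℚ._+_ (ℚ.*-zeroʳ p) (ℚ.*-zeroˡ q)))

fromℚ-n≈n×1 : ∀ n → fromℚ (+ n / 1) ≈ n × 1ᶜ
fromℚ-n≈n×1 zero    = ℂR.refl
fromℚ-n≈n×1 (suc n) = begin
  fromℚ (+ suc n / 1)       ≡⟨ ≡.cong fromℚ ([1+n]/1≡1+n/1 n) ⟩
  fromℚ (1ℚ ℚ.+ + n / 1)    ≈⟨ fromℚ-+ 1ℚ (+ n / 1) ⟩
  1ᶜ + fromℚ (+ n / 1)      ≈⟨ ℂR.+-congˡ {1ᶜ} (fromℚ-n≈n×1 n) ⟩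
  suc n × 1ᶜ                ∎

fromℚ-n* : ∀ n x → fromℚ (+ n / 1) * x ≈ n × x
fromℚ-n* n x = begin
  fromℚ (+ n / 1) * x  ≈⟨ ℂR.*-congʳ {x} (fromℚ-n≈n×1 n) ⟩
  (n × 1ᶜ) * x         ≈⟨ ×-assoc-* n 1ᶜ x ⟩
  n × (1ᶜ * x)         ≈⟨ ×-congʳ n (ℂR.*-identityˡ x) ⟩
  n × x                ∎

1/n*n×-cancel : ∀ n x → fromℚ (1ℤ / suc n) * (suc n × x) ≈ x
1/n*n×-cancel n x = begin
  r * (suc n × x)                   ≈⟨ ℂR.*-congˡ {r} (fromℚ-n* (suc n) x) ⟨
  r * (fromℚ (+ suc n / 1) * x)     ≈⟨ ℂR.*-assoc r (fromℚ (+ suc n / 1)) x ⟨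
  r * fromℚ (+ suc n / 1) * x       ≈⟨ ℂR.*-congʳ {x} (fromℚ-* (1ℤ / suc n) (+ suc n / 1)) ⟨
  fromℚ ((1ℤ / suc n) ℚ.* (+ suc n / 1)) * x
                                    ≡⟨ ≡.cong (λ q → fromℚ q * x) (1/n*n≡1 n) ⟩
  1ᶜ * x                            ≈⟨ ℂR.*-identityˡ x ⟩
  x                                 ∎
  where r = fromℚ (1ℤ / suc n)

n×1/n*-cancel : ∀ n x → suc n × (fromℚ (1ℤ / suc n) * x) ≈ x
n×1/n*-cancel n x = begin
  suc n × (r * x)  ≈⟨ ×-comm-* (suc n) r x ⟨
  r * (suc n × x)  ≈⟨ 1/n*n×-cancel n x ⟩
  x                ∎
  where
  open Mult ℂR.semiring using (×-comm-*)
  r = fromℚ (1ℤ / suc n)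

-- Multiplication by the rational scalar 1/(n + 1) undoes the multiple.
ℂ-torsionFree : ∀ n {x y} → suc n × x ≈ suc n × y → x ≈ y
ℂ-torsionFree n {x} {y} nx≈ny = begin
  x                                  ≈⟨ 1/n*n×-cancel n x ⟨
  fromℚ (1ℤ / suc n) * (suc n × x)   ≈⟨ ℂR.*-congˡ {fromℚ (1ℤ / suc n)} nx≈ny ⟩
  fromℚ (1ℤ / suc n) * (suc n × y)   ≈⟨ 1/n*n×-cancel n y ⟩
  y                                  ∎

-- Transfer to power series over ℂ.

-- 1ₚ and F.1ₚ are distinct definitions by cases, so they, and hence the powers,
-- agree only up to ≈ₚ; the other operations agree definitionally.
1ₚ-agrees : 1ₚ ≈ₚ F.1ₚ
1ₚ-agrees zero    = ℂR.refl
1ₚ-agrees (suc k) = ℂR.refl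

^-agrees : ∀ f m → f ^ m ≈ₚ f F.^ m
^-agrees f zero    = 1ₚ-agrees
^-agrees f (suc m) = F.P.*-congˡ {f} (^-agrees f m)

theorem3p2 : (f : PowerSeries) (c₀#0 : [x^ 0 ] f # 0ᶜ) (a b : ℕ → ℂ) →
    (∀ n → .{{_ : NonZero n}} →
    a n ≈ fromℚ (+ n / 1) * ∑[1≤ m ≤ n ] ([x^ n ∸ m ] (f ^ m) * b m))
    ⇔
    (∀ n → .{{_ : NonZero n}} →
    b n ≈ fromℚ (1ℤ / n) * ∑[1≤ m ≤ n ] ([x^ n ∸ m ] (inverse f c₀#0 ^ n) * a m))
theorem3p2 f c₀#0 a b = mk⇔ to from
  where
  g = inverse f c₀#0

  f*g≈1 : f *ₚ g ≈ₚ F.1ₚ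
  f*g≈1 k = ℂR.trans (*ₚ-inverse f c₀#0 k) (1ₚ-agrees k)

  open F.LagrangeInversion ℂ-torsionFree f g f*g≈1

  S T : ℕ → ℂ
  S n = ∑[1≤ m ≤ n ] ([x^ n ∸ m ] (f ^ m) * b m)
  T n = ∑[1≤ m ≤ n ] ([x^ n ∸ m ] (g ^ n) * a m)

  nS≈A : ∀ n → fromℚ (+ n / 1) * S n ≈ A b n
  nS≈A n = ℂR.trans (fromℚ-n* n (S n)) (×-congʳ n (sum-cong-≋ {n} λ i →
    ℂR.*-congʳ {b (suc (toℕ i))} (^-agrees f (suc (toℕ i)) (n ∸ suc (toℕ i)))))

  T≈C : ∀ n → T n ≈ C a n
  T≈C n = sum-cong-≋ {n} λ i →
    ℂR.*-congʳ {a (suc (toℕ i))} (^-agrees g n (n ∸ suc (toℕ i)))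

  to : (∀ n → .{{_ : NonZero n}} → a n ≈ fromℚ (+ n / 1) * S n) →
       ∀ n → .{{_ : NonZero n}} → b n ≈ fromℚ (1ℤ / n) * T n
  to a≈nS (suc n) = begin
    b (suc n)
      ≈⟨ 1/n*n×-cancel n (b (suc n)) ⟨
    fromℚ (1ℤ / suc n) * (suc n × b (suc n))
      -- The first condition is a = A b after rewriting scalars and powers, so `A⇒C` supplies n bₙ,
      -- and the prefactor divides it by n.
      ≈⟨ ℂR.*-congˡ {fromℚ (1ℤ / suc n)} (A⇒C a b (λ m →
           ℂR.trans (a≈nS (suc m)) (nS≈A (suc m))) n) ⟩
    fromℚ (1ℤ / suc n) * C a (suc n)
      ≈⟨ ℂR.*-congˡ {fromℚ (1ℤ / suc n)} (T≈C (suc n)) ⟨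
    fromℚ (1ℤ / suc n) * T (suc n) ∎

  from : (∀ n → .{{_ : NonZero n}} → b n ≈ fromℚ (1ℤ / n) * T n) →
         ∀ n → .{{_ : NonZero n}} → a n ≈ fromℚ (+ n / 1) * S n
  from b≈T/n (suc n) = ℂR.trans (C⇒A a b nb≈C n) (ℂR.sym (nS≈A (suc n)))
    where
    nb≈C : ∀ n → suc n × b (suc n) ≈ C a (suc n)
    nb≈C n = begin
      suc n × b (suc n)                         ≈⟨ ×-congʳ (suc n) (b≈T/n (suc n)) ⟩
      suc n × (fromℚ (1ℤ / suc n) * T (suc n))  ≈⟨ n×1/n*-cancel n (T (suc n)) ⟩
      T (suc n)                                 ≈⟨ T≈C (suc n) ⟩
      C a (suc n)                               ∎
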